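{- For every even integer $n \ge 16$, there exists a connected cubic (that is, $3$-regular) simple graph $G$ of order $n$ whose coalition number satisfies $C(G) = 9$.
   Context: All graphs are finite, undirected, simple and connected. The order of a graph is its number of vertices. For a graph $G=(V,E)$, a set $S \subseteq V$ is a dominating set if every vertex of $V \setminus S$ is adjacent to at least one vertex of $S$. A coalition in $G$ consists of two disjoint sets $V_1, V_2 \subset V$ such that neither $V_1$ nor $V_2$ is a dominating set of $G$, but the union $V_1 \cup V_2$ is a dominating set of $G$; one then says that $V_1$ forms a coalition with $V_2$. A coalition partition of a graph $G$ of order $n$ is a partition $\mathcal{P} = \{V_1, V_2, \dots, V_k\}$ of the vertex set $V$ (into nonempty sets) such that every set $V_i$ either is a dominating set consisting of a single vertex of degree $n-1$, or is not a dominating set but forms a coalition with another set $V_j \in \mathcal{P}$ that is not a dominating set. The coalition number $C(G)$ is the maximum cardinality $k$ of a coalition partition of $G$. -}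

module Defs where

open import Data.Fin.Base using (Fin)
open import Data.Fin.Subset using (Subset; _∈_; _∉_; _∩_; _∪_; ⁅_⁆; ∣_∣; Nonempty; Empty)
open import Data.Nat.Base using (ℕ; _≤_; _∸_)
open import Data.Product.Base using (∃; ∃-syntax; _×_)
open import Data.Sum.Base using (_⊎_)
open import Data.Vec.Base using (tabulate)
open import Level using (0ℓ)
open import Relation.Binary.Construct.Closure.ReflexiveTransitive using (Star)
open import Relation.Binary.Core using (Rel)
open import Relation.Binary.Definitions using (Decidable; Symmetric)
open import Relation.Binary.PropositionalEquality.Core using (_≡_; _≢_)
open import Relation.Nullary.Decidable.Core using (does)
open import Relation.Nullary.Negation.Core using (¬_)

-- Finite simple undirected graphs of order n, with vertex set Fin n.
record Graph (n : ℕ) : Set₁ where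
  infix 4 _~_ _~?_
  field
    _~_      : Rel (Fin n) 0ℓ
    _~?_     : Decidable _~_
    ~-sym    : Symmetric _~_
    ~-irrefl : ∀ {v} → ¬ (v ~ v)

  neighbourhood : Fin n → Subset n
  neighbourhood v = tabulate λ w → does (v ~? w)

  degree : Fin n → ℕ
  degree v = ∣ neighbourhood v ∣

  Connected : Set
  Connected = ∀ u v → Star _~_ u v

  Cubic : Set
  Cubic = ∀ v → degree v ≡ 3

  Dominating : Subset n → Set
  Dominating S = ∀ v → v ∉ S → ∃[ u ] u ∈ S × v ~ u

  record Coalition (A B : Subset n) : Set where
    field
      disjoint       : Empty (A ∩ B)
      ¬dominatingˡ   : ¬ Dominating A
      ¬dominatingʳ   : ¬ Dominating B
      ∪-dominating   : Dominating (A ∪ B)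

-- Partition into exactly k parts: nonemptiness and disjointness make the
-- family V injective, so k is the cardinality of {V i}.
record IsPartition {n k : ℕ} (V : Fin k → Subset n) : Set where
  field
    nonempty : ∀ i → Nonempty (V i)
    disjoint : ∀ {i j} → i ≢ j → Empty (V i ∩ V j)
    covering : ∀ v → ∃[ i ] v ∈ V i

module _ {n : ℕ} (G : Graph n) where
  open Graph G

  -- In the second alternative, Coalition already says that neither V i nor
  -- V j is dominating.
  record IsCoalitionPartition {k : ℕ} (V : Fin k → Subset n) : Set where
    field
      isPartition : IsPartition V
      coalition   : ∀ i →
        (Dominating (V i) × ∃[ v ] V i ≡ ⁅ v ⁆ × degree v ≡ n ∸ 1)
        ⊎ (∃[ j ] j ≢ i × Coalition (V i) (V j))

  HasCoalitionPartition : ℕ → Set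
  HasCoalitionPartition k = ∃ λ (V : Fin k → Subset n) → IsCoalitionPartition V

  -- C(G) = c, where C(G) is the maximum size of a coalition partition.
  CoalitionNumber : ℕ → Set
  CoalitionNumber c =
    HasCoalitionPartition c × (∀ k → HasCoalitionPartition k → k ≤ c)

{-# OPTIONS --safe #-}

-- Upper bound.  In the graph whose edges are the coalitions of a partition into
-- k parts, every part has a neighbour, so there is a spanning forest of t stars,
-- each with at least one leaf.  For every vertex v the (at most 4) parts meeting
-- N[v] form a vertex cover, and every part is avoided by such a cover.  A cover
-- avoiding a centre c contains all leaves of c and a vertex of each other star,
-- so c has at most 4 - (t - 1) leaves, and k ≤ t (6 - t) ≤ 9.
--
-- Lower bound.  Equality forces three stars with two leaves each.  Colour the
-- vertices by the nine parts; the union of each centre with each of its leaves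
-- dominates if every closed neighbourhood meets each star in its centre or in
-- both leaves.  Such colourings of cubic graphs of orders 16 and 18 are given
-- explicitly, and an edge whose ends have two different centres as colours can
-- be replaced by a path through a diamond, adding four vertices whose closed
-- neighbourhoods contain all three centres.

module Submission where

open import Defs
open import Data.Bool.Base using (Bool; true; false; T; _∧_; not)
open import Data.Bool.Properties using (T?; ∧-identityʳ; ∨-identityʳ)
open import Data.Empty using (⊥)
open import Data.Fin.Base using (Fin; zero; suc; toℕ; inject₁; splitAt; _↑ʳ_)
open import Data.Fin.Induction using (<-weakInduction)
open import Data.Fin.Patterns using (0F; 1F; 2F; 3F; 4F; 5F; 6F; 7F; 8F)
open import Data.Fin.Properties using (_≟_; any?; all?; injective⇒≤)
open import Data.Fin.Subset using (Subset; ∣_∣)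
import Data.Fin.Subset as Subset
open import Data.Fin.Subset.Properties
  using (x∈p∩q⁺; x∈p∩q⁻; x∈p∪q⁺; x∈p∪q⁻; ∪-comm; ∩-comm)
  renaming (_∈?_ to _∈ˢ?_)
open import Data.List.Base
  using (List; []; _∷_; _++_; length; map; filter; concatMap; allFin)
import Data.List.Base as List
open import Data.List.Membership.Propositional using (_∈_; _∉_; lose)
import Data.List.Membership.DecPropositional as DecMembership
open import Data.List.Membership.Propositional.Properties
  using (∈-lookup; ∈-filter⁺; ∈-filter⁻; ∈-map⁺; ∈-map⁻; ∈-allFin; ∈-concatMap⁺; ∈-++⁻)
open import Data.List.Properties using (length-map; length-++; length-tabulate)
open import Data.List.Relation.Binary.Subset.Propositional using (_⊆_)
open import Data.List.Relation.Unary.All using (All; []; _∷_)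
import Data.List.Relation.Unary.All as All
open import Data.List.Relation.Unary.AllPairs using ([]; _∷_)
open import Data.List.Relation.Unary.Any using (here; there; index)
open import Data.List.Relation.Unary.Any.Properties using (lookup-index)
open import Data.List.Relation.Unary.Unique.Propositional using (Unique)
open import Data.List.Relation.Unary.Unique.Propositional.Properties
  using (allFin⁺; filter⁺; ++⁺)
open import Data.Nat.Base using (ℕ; zero; suc; _+_; _*_; _∸_; _≤_; z≤n; s≤s; _≥_)
open import Data.Nat.Divisibility using (_∣_; divides)
import Data.Nat.Properties as ℕ
open import Data.Product.Base using (∃; ∃-syntax; _×_; _,_; proj₁; proj₂)
open import Data.Sum.Base using (_⊎_; inj₁; inj₂; [_,_]′)
import Data.Sum.Base as Sum
open import Data.Vec.Base using (Vec; []; _∷_; lookup; tabulate)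
open import Data.Vec.Properties
  using (tabulate-cong; lookup∘tabulate; []=⇒lookup; lookup⇒[]=)
open import Function.Base using (id; _∘_)
open import Level using (0ℓ)
open import Relation.Binary.Construct.Closure.ReflexiveTransitive
  using (Star; ε; _◅_; _◅◅_; reverse; kleisliStar)
open import Relation.Binary.Core using (Rel)
open import Relation.Binary.Definitions using (Symmetric) renaming (Decidable to Decidable₂)
open import Relation.Binary.PropositionalEquality
  using (_≡_; _≢_; refl; sym; trans; cong; subst)
open import Relation.Nullary using (¬_; Dec; yes; no; does; contradiction)
open import Relation.Nullary.Decidable
  using (_×-dec_; _⊎-dec_; _→-dec_; ¬?; True; toWitness; from-yes; from-no; dec-true; decidable-stable)
open import Relation.Unary using (Pred; Decidable)

-- Duplicate-free lists, subset sizes and function updates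

private variable
  A : Set
  m n k : ℕ

lookup-injective : {xs : List A} → Unique xs → ∀ i j → List.lookup xs i ≡ List.lookup xs j → i ≡ j
lookup-injective (x∉ ∷ u) zero    zero    _  = refl
lookup-injective (x∉ ∷ u) zero    (suc j) eq = contradiction eq (All.lookup x∉ (∈-lookup j))
lookup-injective (x∉ ∷ u) (suc i) zero    eq = contradiction (sym eq) (All.lookup x∉ (∈-lookup i))
lookup-injective (x∉ ∷ u) (suc i) (suc j) eq = cong suc (lookup-injective u i j eq)

-- Pigeonhole: positions in `xs` map injectively to positions in `ys`.
Unique⇒length≤ : {xs ys : List A} → Unique xs → xs ⊆ ys → length xs ≤ length ys
Unique⇒length≤ {xs = xs} {ys} u sub = injective⇒≤ {f = position} position-injective
  where
  position : Fin (length xs) → Fin (length ys)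
  position i = index (sub (∈-lookup i))

  lookup-position : ∀ i → List.lookup xs i ≡ List.lookup ys (position i)
  lookup-position i = lookup-index (sub (∈-lookup i))

  position-injective : ∀ {i j} → position i ≡ position j → i ≡ j
  position-injective {i} {j} eq = lookup-injective u i j
    (trans (lookup-position i) (trans (cong (List.lookup ys) eq) (sym (lookup-position j))))

length-concatMap≤ : {B : Set} (f : A → List B) (xs : List A) →
  (∀ {x} → x ∈ xs → length (f x) ≤ m) → length (concatMap f xs) ≤ length xs * m
length-concatMap≤ f []       bound = z≤n
length-concatMap≤ {m = m} f (x ∷ xs) bound = begin
  length (f x ++ concatMap f xs)        ≡⟨ length-++ (f x) ⟩
  length (f x) + length (concatMap f xs) ≤⟨ ℕ.+-mono-≤ (bound (here refl)) (length-concatMap≤ f xs (bound ∘ there)) ⟩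
  m + length xs * m                      ∎
  where open ℕ.≤-Reasoning

-- Turns a degree, which is the size of a subset, into the length of a list of neighbours.
∣tabulate∣≡length-filter : {P : Pred A 0ℓ} (P? : Decidable P) (f : Fin n → A) →
  ∣ tabulate (does ∘ P? ∘ f) ∣ ≡ length (filter P? (List.tabulate f))
∣tabulate∣≡length-filter {n = zero}  P? f = refl
∣tabulate∣≡length-filter {n = suc n} P? f with does (P? (f zero))
... | true  = cong suc (∣tabulate∣≡length-filter P? (f ∘ suc))
... | false = ∣tabulate∣≡length-filter P? (f ∘ suc)

∈-filter-allFin⁻ : {P : Pred (Fin n) 0ℓ} (P? : Decidable P) {i : Fin n} →
  i ∈ filter P? (allFin n) → P i
∈-filter-allFin⁻ P? = proj₂ ∘ ∈-filter⁻ P? {xs = allFin _}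

infix 6 _[_↦_]

_[_↦_] : (Fin k → A) → Fin k → A → Fin k → A
(f [ i ↦ a ]) j with j ≟ i
... | yes _ = a
... | no  _ = f j

↦-updates : (f : Fin k → A) (i : Fin k) (a : A) → (f [ i ↦ a ]) i ≡ a
↦-updates f i a with i ≟ i
... | yes _  = refl
... | no i≢i = contradiction refl i≢i

↦-minimal : (f : Fin k → A) {i j : Fin k} (a : A) → j ≢ i → (f [ i ↦ a ]) j ≡ f j
↦-minimal f {i} {j} a j≢i with j ≟ i
... | yes j≡i = contradiction j≡i j≢i
... | no  _   = refl

-- Spanning star forests

-- A forest of stars, each vertex being sent to the centre of its star.
record StarForest {k : ℕ} (R : Rel (Fin k) 0ℓ) (f : Fin k → Fin k) : Set where
  field
    idem : ∀ i → f (f i) ≡ f i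
    edge : ∀ i → f i ≢ i → R i (f i)

-- Excludes one-vertex stars: `i` is a leaf, or a centre with at least one leaf.
Covered : (Fin k → Fin k) → Fin k → Set
Covered f i = f i ≢ i ⊎ (∃[ j ] j ≢ i × f j ≡ i)

covered? : (f : Fin k → Fin k) → Decidable (Covered f)
covered? f i with f i ≟ i | any? (λ j → ¬? (j ≟ i) ×-dec f j ≟ i)
... | no  fi≢i | _        = yes (inj₁ fi≢i)
... | yes _    | yes leaf = yes (inj₂ leaf)
... | yes fi≡i | no ¬leaf = no [ (λ fi≢i → fi≢i fi≡i) , ¬leaf ]′

module _ {k : ℕ} {R : Rel (Fin k) 0ℓ} (R-sym : Symmetric R) where
  open StarForest

  private variable
    f : Fin k → Fin k

  -- The isolated vertex `i` becomes a leaf of the centre `q`. Nothing else was sent to `i`, so the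
  -- new map is still idempotent.
  attach : ∀ {i q} → StarForest R f → f q ≡ q → q ≢ i → R i q → ¬ Covered f i →
    ∃ λ g → StarForest R g × Covered g i × Covered g q × (∀ j → Covered f j → Covered g j)
  attach {f} {i} {q} F fq≡q q≢i Riq ¬cov = g
    , record { idem = g-idem ; edge = g-edge }
    , inj₁ (λ eq → q≢i (trans (sym gi≡q) eq))
    , inj₂ (i , (λ i≡q → q≢i (sym i≡q)) , gi≡q)
    , λ j → λ where
        (inj₁ fj≢j) → inj₁ λ gj≡j →
          fj≢j (trans (sym (g≡f λ { refl → fj≢j fi≡i })) gj≡j)
        (inj₂ (l , l≢j , fl≡j)) → inj₂ (l , l≢j ,
          trans (g≡f λ { refl → l≢j (trans (sym fi≡i) fl≡j) }) fl≡j)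
    where
    g : Fin k → Fin k
    g = f [ i ↦ q ]

    gi≡q : g i ≡ q
    gi≡q = ↦-updates f i q

    g≡f : ∀ {j} → j ≢ i → g j ≡ f j
    g≡f = ↦-minimal f q

    fi≡i : f i ≡ i
    fi≡i = decidable-stable (f i ≟ i) (¬cov ∘ inj₁)

    g-idem : ∀ j → g (g j) ≡ g j
    g-idem j with j ≟ i
    ... | yes _  = trans (g≡f q≢i) fq≡q
    ... | no j≢i = trans (g≡f λ fj≡i → ¬cov (inj₂ (j , j≢i , fj≡i))) (idem F j)

    g-edge : ∀ j → g j ≢ j → R j (g j)
    g-edge j with j ≟ i
    ... | yes refl = λ _ → Riq
    ... | no _     = edge F j

  -- A leaf is split off its star; if it is the only leaf it trades places with
  -- the centre instead, so that the centre does not become isolated.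
  promote : ∀ q → StarForest R f →
    ∃ λ g → StarForest R g × g q ≡ q × (∀ j → j ≢ q → Covered f j → Covered g j)
          × (∀ j → j ≢ q → Covered g j → Covered f j)
  promote {f} q F with f q ≟ q
  ... | yes fq≡q = f , F , fq≡q , (λ _ _ c → c) , (λ _ _ c → c)
  ... | no  fq≢q with any? (λ j → ¬? (j ≟ q) ×-dec ¬? (j ≟ f q) ×-dec (f j ≟ f q))
  ...   | yes (j₀ , j₀≢q , j₀≢fq , fj₀≡fq) = g
    , record { idem = g-idem ; edge = g-edge }
    , gq≡q
    , (λ j j≢q → λ where
        (inj₁ fj≢j) → inj₁ λ gj≡j → fj≢j (trans (sym (g≡f j≢q)) gj≡j)
        (inj₂ (l , l≢j , fl≡j)) → still-centre j l l≢j fl≡j)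
    , (λ j j≢q → λ where
        (inj₁ gj≢j) → inj₁ λ fj≡j → gj≢j (trans (g≡f j≢q) fj≡j)
        (inj₂ (l , l≢j , gl≡j)) → inj₂ (l , l≢j ,
          trans (sym (g≡f λ { refl → j≢q (trans (sym gl≡j) gq≡q) })) gl≡j))
    where
    g : Fin k → Fin k
    g = f [ q ↦ q ]

    gq≡q : g q ≡ q
    gq≡q = ↦-updates f q q

    g≡f : ∀ {j} → j ≢ q → g j ≡ f j
    g≡f = ↦-minimal f q

    g-idem : ∀ j → g (g j) ≡ g j
    g-idem j with j ≟ q
    ... | yes _ = gq≡q
    ... | no  _ = trans (g≡f λ fj≡q → fq≢q (trans (cong f (sym fj≡q)) (trans (idem F j) fj≡q))) (idem F j)

    g-edge : ∀ j → g j ≢ j → R j (g j)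
    g-edge j with j ≟ q
    ... | yes j≡q = λ q≢j → contradiction (sym j≡q) q≢j
    ... | no  _   = edge F j

    still-centre : ∀ j l → l ≢ j → f l ≡ j → Covered g j
    still-centre j l l≢j fl≡j with l ≟ q
    -- If the leaf witnessing that `j` is covered is `q` itself, the second leaf `j₀` of the same
    -- star replaces it.
    ... | yes refl = inj₂ (j₀ , (λ j₀≡j → j₀≢fq (trans j₀≡j (sym fl≡j))) , trans (g≡f j₀≢q) (trans fj₀≡fq fl≡j))
    ... | no l≢q   = inj₂ (l , l≢j , trans (g≡f l≢q) fl≡j)
  ...   | no ¬other = g
    , record { idem = g-idem ; edge = g-edge }
    , gq≡q
    , (λ j j≢q → λ where
        (inj₁ fj≢j) → inj₁ λ gj≡j → fj≢j (trans (sym (g≡f j≢q λ { refl → fj≢j (idem F q) })) gj≡j)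
        (inj₂ (l , l≢j , fl≡j)) → still-covered j l l≢j fl≡j)
    , (λ j j≢q → λ where
        (inj₁ gj≢j) → was-covered j j≢q gj≢j
        (inj₂ (l , l≢j , gl≡j)) → inj₂ (l , l≢j ,
          trans (sym (g≡f (λ { refl → j≢q (trans (sym gl≡j) gq≡q) })
                          (λ { refl → j≢q (trans (sym gl≡j) gr≡q) }))) gl≡j))
    where
    r : Fin k
    r = f q

    g : Fin k → Fin k
    g = f [ r ↦ q ] [ q ↦ q ]

    gq≡q : g q ≡ q
    gq≡q = ↦-updates (f [ r ↦ q ]) q q

    gr≡q : g r ≡ q
    gr≡q = trans (↦-minimal (f [ r ↦ q ]) q fq≢q) (↦-updates f r q)

    g≡f : ∀ {j} → j ≢ q → j ≢ r → g j ≡ f j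
    g≡f j≢q j≢r = trans (↦-minimal (f [ r ↦ q ]) q j≢q) (↦-minimal f q j≢r)

    classify : (P : Fin k → Set) → P q → P r → (∀ j → j ≢ q → j ≢ r → P j) → ∀ j → P j
    classify P Pq Pr Pj j with j ≟ q | j ≟ r
    ... | yes refl | _        = Pq
    ... | no _     | yes refl = Pr
    ... | no j≢q   | no j≢r   = Pj j j≢q j≢r

    g-idem : ∀ j → g (g j) ≡ g j
    g-idem = classify _ (cong g gq≡q) (trans (cong g gr≡q) (trans gq≡q (sym gr≡q)))
      λ j j≢q j≢r → trans (cong g (g≡f j≢q j≢r)) (trans
        (g≡f (λ fj≡q → fq≢q (trans (cong f (sym fj≡q)) (trans (idem F j) fj≡q)))
             (λ fj≡r → ¬other (j , j≢q , j≢r , fj≡r)))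
        (trans (idem F j) (sym (g≡f j≢q j≢r))))

    g-edge : ∀ j → g j ≢ j → R j (g j)
    g-edge = classify (λ j → g j ≢ j → R j (g j)) (contradiction gq≡q)
      -- The edge from leaf `q` to centre `r` is now used in the opposite direction, by symmetry of
      -- `R`.
      (λ _ → subst (R r) (sym gr≡q) (R-sym (edge F q fq≢q)))
      λ j j≢q j≢r gj≢j → subst (R j) (sym (g≡f j≢q j≢r)) (edge F j (gj≢j ∘ trans (g≡f j≢q j≢r)))

    still-covered : ∀ j l → l ≢ j → f l ≡ j → Covered g j
    still-covered j l l≢j fl≡j with j ≟ r
    ... | yes refl = inj₁ λ gr≡r → fq≢q (trans (sym gr≡r) gr≡q)
    ... | no j≢r   = inj₂ (l , l≢j , trans
      (g≡f (λ { refl → j≢r (sym fl≡j) }) (λ { refl → l≢j (trans (sym (idem F q)) fl≡j) })) fl≡j)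

    was-covered : ∀ j → j ≢ q → g j ≢ j → Covered f j
    was-covered j j≢q gj≢j with j ≟ r
    ... | yes refl = inj₂ (q , (λ q≡r → fq≢q (sym q≡r)) , refl)
    ... | no j≢r   = inj₁ λ fj≡j → gj≢j (trans (g≡f j≢q j≢r) fj≡j)

  module _ (partner : ∀ i → ∃[ j ] j ≢ i × R i j) where

    -- Promote a partner `q` of `i` to a centre, then attach `i` to it. Promotion may leave `q`
    -- itself uncovered, but attaching `i` repairs this.
    cover : ∀ i → StarForest R f →
      ∃ λ g → StarForest R g × Covered g i × (∀ j → Covered f j → Covered g j)
    cover {f} i F with covered? f i
    ... | yes cov = f , F , cov , λ _ c → c
    ... | no ¬cov with partner i
    ... | q , q≢i , Riq with promote q F
    ... | g , G , gq≡q , f⇒g , g⇒f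
      with attach G gq≡q q≢i Riq (¬cov ∘ g⇒f i (λ i≡q → q≢i (sym i≡q)))
    ... | h , H , covᵢ , cov-q , g⇒h = h , H , covᵢ , f⇒h
      where
      f⇒h : ∀ j → Covered f j → Covered h j
      f⇒h j c with j ≟ q
      ... | yes refl = cov-q
      ... | no j≢q   = g⇒h j (f⇒g j j≢q c)

    coverAll : (xs : List (Fin k)) → ∃ λ f → StarForest R f × All (Covered f) xs
    -- The start is the forest in which every vertex is a star of its own.
    coverAll []       = id , record { idem = λ _ → refl ; edge = λ _ i≢i → contradiction refl i≢i } , []
    coverAll (x ∷ xs) with coverAll xs
    ... | f , F , covs with cover x F
    ... | g , G , cov , f⇒g = g , G , cov ∷ All.map (f⇒g _) covs

    spanningStarForest : ∃ λ f → StarForest R f × ∀ i → Covered f i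
    spanningStarForest with coverAll (allFin k)
    ... | f , F , covs = f , F , λ i → All.lookup covs (∈-allFin i)

-- Bounding the order by small vertex covers

module _ {k d : ℕ} {R : Rel (Fin k) 0ℓ} {f : Fin k → Fin k}
  (F : StarForest R f) (covered : ∀ i → Covered f i)
  (avoiding : ∀ c → ∃ λ (H : List (Fin k)) →
    c ∉ H × length H ≤ d × (∀ {i j} → R i j → i ∈ H ⊎ j ∈ H)) where
  open StarForest F
  open DecMembership (_≟_ {k}) using (_∈?_)

  centre? : Decidable (λ i → f i ≡ i)
  centre? i = f i ≟ i

  leaf? : ∀ c → Decidable (λ j → j ≢ c × f j ≡ c)
  leaf? c j = ¬? (j ≟ c) ×-dec f j ≟ c

  centres : List (Fin k)
  centres = filter centre? (allFin k)

  leaves : Fin k → List (Fin k)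
  leaves c = filter (leaf? c) (allFin k)

  -- A vertex cover `H` avoiding `c` contains every leaf of `c` and meets every other star. The
  -- extra `suc` accounts for `c` itself.
  leaves+centres : ∀ {c} → f c ≡ c → length (leaves c) + length centres ≤ suc d
  leaves+centres {c} fc≡c with avoiding c
  ... | H , c∉H , |H|≤d , vertexCover = begin
    length (leaves c) + length centres ≡⟨ length-++ (leaves c) ⟨
    length (leaves c ++ centres)       ≤⟨ Unique⇒length≤ unique sub ⟩
    suc (length (map φ H))             ≡⟨ cong suc (length-map φ H) ⟩
    suc (length H)                     ≤⟨ s≤s |H|≤d ⟩
    suc d                              ∎
    where
    open ℕ.≤-Reasoning

    -- Keeps the vertices in the star of `c` and sends all others to their centres, so that
    -- `map φ H` contains the leaves of `c` and all centres other than `c`.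
    φ : Fin k → Fin k
    φ h with f h ≟ c
    ... | yes _ = h
    ... | no  _ = f h

    φ-leaf : ∀ {h} → f h ≡ c → φ h ≡ h
    φ-leaf {h} eq with f h ≟ c
    ... | yes _ = refl
    ... | no ne = contradiction eq ne

    φ-other : ∀ {h} → f h ≢ c → φ h ≡ f h
    φ-other {h} ne with f h ≟ c
    ... | yes eq = contradiction eq ne
    ... | no _   = refl

    leaf⇒ : ∀ {j} → j ∈ leaves c → j ≢ c × f j ≡ c
    leaf⇒ = ∈-filter-allFin⁻ (leaf? c)

    centre⇒ : ∀ {j} → j ∈ centres → f j ≡ j
    centre⇒ = ∈-filter-allFin⁻ centre?

    unique : Unique (leaves c ++ centres)
    unique = ++⁺ (filter⁺ _ (allFin⁺ k)) (filter⁺ _ (allFin⁺ k))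
      λ { (j∈l , j∈c) → let j≢c , fj≡c = leaf⇒ j∈l in j≢c (trans (sym (centre⇒ j∈c)) fj≡c) }

    leaf∈H : ∀ {l} → l ≢ c → f l ≡ c → l ∈ H
    leaf∈H {l} l≢c fl≡c with vertexCover (edge l (λ fl≡l → l≢c (trans (sym fl≡l) fl≡c)))
    ... | inj₁ l∈H  = l∈H
    ... | inj₂ fl∈H = contradiction (subst (_∈ H) fl≡c fl∈H) c∉H

    fibre∩H : ∀ {e} → f e ≡ e → ∃[ h ] h ∈ H × f h ≡ e
    fibre∩H {e} fe≡e with covered e
    ... | inj₁ fe≢e = contradiction fe≡e fe≢e
    ... | inj₂ (l , l≢e , fl≡e) with vertexCover (edge l (λ fl≡l → l≢e (trans (sym fl≡l) fl≡e)))
    ...   | inj₁ l∈H  = l , l∈H , fl≡e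
    ...   | inj₂ fl∈H = e , subst (_∈ H) fl≡e fl∈H , fe≡e

    sub : leaves c ++ centres ⊆ c ∷ map φ H
    sub {e} e∈ with e ≟ c | ∈-++⁻ (leaves c) e∈
    ... | yes refl | _ = here refl
    ... | no  _    | inj₁ e∈l = there (subst (_∈ map φ H) (φ-leaf fe≡c) (∈-map⁺ φ (leaf∈H e≢c fe≡c)))
      where
      e≢c = proj₁ (leaf⇒ e∈l)
      fe≡c = proj₂ (leaf⇒ e∈l)
    ... | no  e≢c  | inj₂ e∈c with fibre∩H (centre⇒ e∈c)
    ...   | h , h∈H , fh≡e = there (subst (_∈ map φ H)
      (trans (φ-other λ fh≡c → e≢c (trans (sym fh≡e) fh≡c)) fh≡e) (∈-map⁺ φ h∈H))

  starForest-order≤ : k ≤ length centres * (suc (suc d) ∸ length centres)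
  starForest-order≤ = begin
    k                              ≡⟨ length-tabulate {n = k} id ⟨
    length (allFin k)              ≤⟨ Unique⇒length≤ (allFin⁺ k) (λ {j} _ → in-star j) ⟩
    length (concatMap star centres) ≤⟨ length-concatMap≤ star centres (λ c∈ →
      -- A star consists of its centre and its leaves; the centre raises `suc d` to `suc (suc d)`.
      ℕ.m+n≤o⇒m≤o∸n _ (s≤s (leaves+centres (∈-filter-allFin⁻ centre? c∈)))) ⟩
    length centres * (suc (suc d) ∸ length centres) ∎
    where
    open ℕ.≤-Reasoning

    star : Fin k → List (Fin k)
    star c = c ∷ leaves c

    in-star : ∀ j → j ∈ concatMap star centres
    in-star j = ∈-concatMap⁺ star (lose (∈-filter⁺ _ (∈-allFin (f j)) (idem j)) j∈star)
      where
      j∈star : j ∈ star (f j)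
      j∈star with j ≟ f j
      ... | yes j≡fj = here j≡fj
      ... | no  j≢fj = there (∈-filter⁺ _ (∈-allFin j) (j≢fj , refl))

-- The upper bound for coalition partitions

t*[6∸t]≤9 : ∀ t → t * (6 ∸ t) ≤ 9
t*[6∸t]≤9 0 = from-yes (0 ℕ.≤? 9)
t*[6∸t]≤9 1 = from-yes (5 ℕ.≤? 9)
t*[6∸t]≤9 2 = from-yes (8 ℕ.≤? 9)
t*[6∸t]≤9 3 = from-yes (9 ℕ.≤? 9)
t*[6∸t]≤9 4 = from-yes (8 ℕ.≤? 9)
t*[6∸t]≤9 5 = from-yes (5 ℕ.≤? 9)
-- From 6 on the truncated difference is zero.
t*[6∸t]≤9 (suc (suc (suc (suc (suc (suc t)))))) rewrite ℕ.0∸n≡0 t | ℕ.*-zeroʳ t = z≤n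

Coalition-sym : {G : Graph n} → Symmetric (Graph.Coalition G)
Coalition-sym {G = G} {A} {B} AB = record
  { disjoint     = subst Subset.Empty (∩-comm A B) disjoint
  ; ¬dominatingˡ = ¬dominatingʳ
  ; ¬dominatingʳ = ¬dominatingˡ
  ; ∪-dominating = subst (Graph.Dominating G) (∪-comm A B) ∪-dominating
  }
  where open Graph.Coalition AB

coalitionPartition≤9 : (G : Graph n) → Graph.Cubic G → n ≥ 16 → ∀ k → HasCoalitionPartition G k → k ≤ 9
coalitionPartition≤9 {n} G cubic n≥16 k (V , isCP) =
  let f , F , covered = spanningStarForest {R = R} (λ {i} {j} → Coalition-sym {G = G} {V i} {V j}) partner
  in ℕ.≤-trans (starForest-order≤ F covered avoiding) (t*[6∸t]≤9 (length (centres F covered avoiding)))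
  where
  open Graph G
  open IsCoalitionPartition isCP
  open IsPartition isPartition
  open DecMembership (_≟_ {k}) using (_∈?_)

  R : Rel (Fin k) 0ℓ
  R i j = Coalition (V i) (V j)

  -- Rules out the singleton dominating parts, so every part has a coalition partner.
  3≢n∸1 : 3 ≢ n ∸ 1
  3≢n∸1 eq = contradiction (subst (15 ≤_) (sym eq) (ℕ.∸-monoˡ-≤ 1 n≥16)) (from-no (15 ℕ.≤? 3))

  partner : ∀ i → ∃[ j ] j ≢ i × R i j
  partner i with coalition i
  ... | inj₁ (_ , v , _ , deg) = contradiction (trans (sym (cubic v)) deg) 3≢n∸1
  ... | inj₂ p                 = p

  part : Fin n → Fin k
  part v = proj₁ (covering v)

  ∈⇒part : ∀ {v i} → v Subset.∈ V i → part v ≡ i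
  ∈⇒part {v} {i} v∈Vi with part v ≟ i
  ... | yes eq = eq
  ... | no  ne = contradiction (v , x∈p∩q⁺ (proj₂ (covering v) , v∈Vi)) (disjoint ne)

  neighbours : Fin n → List (Fin n)
  neighbours v = filter (v ~?_) (allFin n)

  -- The parts meeting the closed neighbourhood of `v`, listed with repetitions. Each is a vertex
  -- cover of the coalition graph, since a dominating union meets every closed neighbourhood.
  H : Fin n → List (Fin k)
  H v = map part (v ∷ neighbours v)

  |H|≤4 : ∀ v → length (H v) ≤ 4
  |H|≤4 v = ℕ.≤-reflexive (cong suc (trans (length-map part (neighbours v))
    (trans (sym (∣tabulate∣≡length-filter (v ~?_) id)) (cubic v))))

  part∈H : ∀ {v w} → v ~ w → part w ∈ H v
  part∈H {v} {w} v~w = there (∈-map⁺ part (∈-filter⁺ (v ~?_) (∈-allFin w) v~w))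

  meets : ∀ v {S} → Dominating S → ∃[ w ] w Subset.∈ S × part w ∈ H v
  meets v {S} dom with v ∈ˢ? S
  ... | yes v∈S = v , v∈S , here refl
  ... | no  v∉S = let w , w∈S , v~w = dom v v∉S in w , w∈S , part∈H v~w

  vertexCover : ∀ v {i j} → R i j → i ∈ H v ⊎ j ∈ H v
  vertexCover v {i} {j} c with meets v (Coalition.∪-dominating c)
  ... | w , w∈∪ , w∈H with x∈p∪q⁻ (V i) (V j) w∈∪
  ...   | inj₁ w∈Vi = inj₁ (subst (_∈ H v) (∈⇒part w∈Vi) w∈H)
  ...   | inj₂ w∈Vj = inj₂ (subst (_∈ H v) (∈⇒part w∈Vj) w∈H)

  ∈H⇒ : ∀ v {i} → i ∈ H v → ∃[ w ] part w ≡ i × (v ≡ w ⊎ v ~ w)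
  ∈H⇒ v (here eq) = v , sym eq , inj₁ refl
  ∈H⇒ v (there p) with ∈-map⁻ part p
  ... | w , w∈ , eq = w , sym eq , inj₂ (∈-filter-allFin⁻ (v ~?_) w∈)

  all∈H⇒dominating : ∀ i → (∀ v → i ∈ H v) → Dominating (V i)
  all∈H⇒dominating i i∈H v v∉Vi with ∈H⇒ v (i∈H v)
  ... | w , refl , inj₁ refl = contradiction (proj₂ (covering w)) v∉Vi
  ... | w , refl , inj₂ v~w  = w , proj₂ (covering w) , v~w

  avoiding : ∀ i → ∃ λ h → i ∉ h × length h ≤ 4 × (∀ {a b} → R a b → a ∈ h ⊎ b ∈ h)
  avoiding i with any? (λ v → ¬? (i ∈? H v))
  ... | yes (v , i∉H) = H v , i∉H , |H|≤4 v , vertexCover v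
  -- A part occurring in every `H v` would be dominating, yet no member of a coalition is.
  ... | no  ¬ex = contradiction
    (all∈H⇒dominating i λ v → decidable-stable (i ∈? H v) λ i∉H → ¬ex (v , i∉H))
    (Coalition.¬dominatingˡ (proj₂ (proj₂ (partner i))))

-- From colourings to coalition partitions

Near : (G : Graph n) → Rel (Fin n) 0ℓ
Near G v w = v ≡ w ⊎ Graph._~_ G v w

near? : (G : Graph n) → Decidable₂ (Near G)
near? G v w = v ≟ w ⊎-dec Graph._~?_ G v w

-- Colours 0, 1, 2 are the centres of the stars; the leaves of star j are the
-- colours 3 + 2 j and 4 + 2 j.
partner : Fin 9 → Fin 9
partner = lookup (3F ∷ 5F ∷ 7F ∷ 0F ∷ 0F ∷ 1F ∷ 1F ∷ 2F ∷ 2F ∷ [])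

-- The edge from u to v is where the graph can be enlarged.
record Colouring {n : ℕ} (G : Graph n) (colour : Fin n → Fin 9) : Set where
  open Graph G
  field
    connected : Connected
    cubic     : Cubic
    -- `dominated` makes the union of the classes of `i` and `partner i` dominating; `missed`
    -- prevents each single class from dominating.
    dominated : ∀ i v → ∃[ w ] Near G v w × (colour w ≡ i ⊎ colour w ≡ partner i)
    missed    : ∀ i → ∃[ v ] (∀ w → Near G v w → colour w ≢ i)
    {u v}     : Fin n
    u~v       : u ~ v
    colour-u  : colour u ≡ 0F
    colour-v  : colour v ≡ 1F

partner-≢ : ∀ i → partner i ≢ i
partner-≢ = from-yes (all? λ i → ¬? (partner i ≟ i))

module _ {G : Graph n} {colour : Fin n → Fin 9} (C : Colouring G colour) where
  open Graph G
  open Colouring C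

  class : Fin 9 → Subset n
  class i = tabulate λ w → does (colour w ≟ i)

  ∈class⁺ : ∀ {w i} → colour w ≡ i → w Subset.∈ class i
  ∈class⁺ {w} {i} eq = lookup⇒[]= w (class i)
    (trans (lookup∘tabulate _ w) (dec-true (colour w ≟ i) eq))

  ∈class⁻ : ∀ {w i} → w Subset.∈ class i → colour w ≡ i
  ∈class⁻ {w} {i} w∈ with colour w ≟ i | trans (sym (lookup∘tabulate (λ x → does (colour x ≟ i)) w)) ([]=⇒lookup w∈)
  ... | yes eq | _ = eq

  ¬dominating-class : ∀ i → ¬ Dominating (class i)
  ¬dominating-class i dom with missed i
  ... | x , miss with dom x (miss x (inj₁ refl) ∘ ∈class⁻)
  ...   | w , w∈ , x~w = miss w (inj₂ x~w) (∈class⁻ w∈)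

  disjoint-classes : ∀ {i j} → i ≢ j → Subset.Empty (class i Subset.∩ class j)
  disjoint-classes {i} {j} i≢j (w , w∈) with x∈p∩q⁻ (class i) (class j) w∈
  ... | w∈i , w∈j = i≢j (trans (sym (∈class⁻ w∈i)) (∈class⁻ w∈j))

  -- Near a vertex that misses the colour `partner i`, only colour `i` can provide domination.
  nonempty-class : ∀ i → Subset.Nonempty (class i)
  nonempty-class i with missed (partner i)
  ... | x , miss with dominated i x
  ...   | w , _    , inj₁ eq = w , ∈class⁺ eq
  ...   | w , near , inj₂ eq = contradiction eq (miss w near)

  dominating-∪ : ∀ i → Dominating (class i Subset.∪ class (partner i))
  dominating-∪ i x x∉ with dominated i x
  ... | w , inj₁ refl , eq = contradiction (x∈p∪q⁺ (Sum.map ∈class⁺ ∈class⁺ eq)) x∉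
  ... | w , inj₂ x~w  , eq = w , x∈p∪q⁺ (Sum.map ∈class⁺ ∈class⁺ eq) , x~w

  coalitionPartition : HasCoalitionPartition G 9
  coalitionPartition = class , record
    { isPartition = record
      { nonempty = nonempty-class
      ; disjoint = disjoint-classes
      ; covering = λ w → colour w , ∈class⁺ refl
      }
    ; coalition = λ i → inj₂ (partner i , partner-≢ i , record
      { disjoint     = disjoint-classes (partner-≢ i ∘ sym)
      ; ¬dominatingˡ = ¬dominating-class i
      ; ¬dominatingʳ = ¬dominating-class (partner i)
      ; ∪-dominating = dominating-∪ i
      })
    }

-- Inserting a diamond into an edge

-- Every pair of partners contains a centre, so a closed neighbourhood with all three centre colours
-- meets every such pair.
centre-≡ : ∀ i → ∃[ c ] (c ≡ 0F ⊎ c ≡ 1F ⊎ c ≡ 2F) × (c ≡ i ⊎ c ≡ partner i)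
centre-≡ = from-yes (all? λ i → any? λ c →
  (c ≟ 0F ⊎-dec c ≟ 1F ⊎-dec c ≟ 2F) ×-dec (c ≟ i ⊎-dec c ≟ partner i))

∣tabulate-remove∣ : (f : Fin n → Bool) (v : Fin n) → f v ≡ true →
  suc ∣ tabulate (λ w → f w ∧ not (does (w ≟ v))) ∣ ≡ ∣ tabulate f ∣
∣tabulate-remove∣ f zero fv rewrite fv =
  cong (suc ∘ ∣_∣) (tabulate-cong λ w → ∧-identityʳ (f (suc w)))
∣tabulate-remove∣ f (suc v) fv with f zero
... | true  = cong suc (∣tabulate-remove∣ (f ∘ suc) v fv)
... | false = ∣tabulate-remove∣ (f ∘ suc) v fv

∣tabulate-⊥∣ : ∀ n → ∣ tabulate {n = n} (λ _ → false) ∣ ≡ 0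
∣tabulate-⊥∣ zero    = refl
∣tabulate-⊥∣ (suc n) = ∣tabulate-⊥∣ n

∣tabulate-≟∣ : (v : Fin n) → ∣ tabulate (λ w → does (w ≟ v)) ∣ ≡ 1
∣tabulate-≟∣ {suc n} zero    = cong suc (∣tabulate-⊥∣ n)
∣tabulate-≟∣ {suc n} (suc v) = ∣tabulate-≟∣ v

-- The edge u v is replaced by a path through a diamond (K₄ without an edge)
-- with vertices 0, 1, 2, 3, where 0 is joined to u and 3 is joined to v.
module Insert (G : Graph n) {u v : Fin n} (u~v : Graph._~_ G u v) where
  open Graph G

  diamond : Fin 4 → Fin 4 → Bool
  diamond i j = lookup (lookup
    ( (false ∷ true  ∷ true  ∷ false ∷ [])
    ∷ (true  ∷ false ∷ true  ∷ true  ∷ [])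
    ∷ (true  ∷ true  ∷ false ∷ true  ∷ [])
    ∷ (false ∷ true  ∷ true  ∷ false ∷ []) ∷ []) i) j

  Port : Fin 4 → Fin n → Set
  Port 0F a = a ≡ u
  Port 1F a = ⊥
  Port 2F a = ⊥
  Port 3F a = a ≡ v

  port? : Decidable₂ Port
  port? 0F a = a ≟ u
  port? 1F a = no λ ()
  port? 2F a = no λ ()
  port? 3F a = a ≟ v

  Cut : Rel (Fin n) 0ℓ
  Cut a b = (a ≡ u × b ≡ v) ⊎ (a ≡ v × b ≡ u)

  cut? : Decidable₂ Cut
  cut? a b = (a ≟ u ×-dec b ≟ v) ⊎-dec (a ≟ v ×-dec b ≟ u)

  cut-sym : Symmetric Cut
  cut-sym (inj₁ (p , q)) = inj₂ (q , p)
  cut-sym (inj₂ (p , q)) = inj₁ (q , p)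

  Adj : Rel (Fin 4 ⊎ Fin n) 0ℓ
  Adj (inj₁ i) (inj₁ j) = T (diamond i j)
  Adj (inj₁ i) (inj₂ b) = Port i b
  Adj (inj₂ a) (inj₁ j) = Port j a
  Adj (inj₂ a) (inj₂ b) = a ~ b × ¬ Cut a b

  adj? : Decidable₂ Adj
  adj? (inj₁ i) (inj₁ j) = T? (diamond i j)
  adj? (inj₁ i) (inj₂ b) = port? i b
  adj? (inj₂ a) (inj₁ j) = port? j a
  adj? (inj₂ a) (inj₂ b) = a ~? b ×-dec ¬? (cut? a b)

  diamond-sym : ∀ i j → T (diamond i j) → T (diamond j i)
  diamond-sym = from-yes (all? λ i → all? λ j → T? (diamond i j) →-dec T? (diamond j i))

  diamond-irrefl : ∀ i → ¬ T (diamond i i)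
  diamond-irrefl = from-yes (all? λ i → ¬? (T? (diamond i i)))

  adj-sym : Symmetric Adj
  adj-sym {inj₁ i} {inj₁ j} = diamond-sym i j
  adj-sym {inj₁ i} {inj₂ b} = λ p → p
  adj-sym {inj₂ a} {inj₁ j} = λ p → p
  adj-sym {inj₂ a} {inj₂ b} (a~b , ¬cut) = ~-sym a~b , ¬cut ∘ cut-sym

  adj-irrefl : ∀ x → ¬ Adj x x
  adj-irrefl (inj₁ i) = diamond-irrefl i
  adj-irrefl (inj₂ a) = ~-irrefl ∘ proj₁

  G⁺ : Graph (4 + n)
  G⁺ = record
    { _~_      = λ x y → Adj (splitAt 4 x) (splitAt 4 y)
    ; _~?_     = λ x y → adj? (splitAt 4 x) (splitAt 4 y)
    ; ~-sym    = λ {x} {y} → adj-sym {splitAt 4 x} {splitAt 4 y}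
    ; ~-irrefl = λ {x} → adj-irrefl (splitAt 4 x)
    }

  open Graph G⁺ using () renaming (_~_ to _~⁺_; Cubic to Cubic⁺; Connected to Connected⁺; degree to degree⁺; ~-sym to ~⁺-sym)

  old : Fin n → Fin (4 + n)
  old = 4 ↑ʳ_

  u≢v : u ≢ v
  u≢v refl = ~-irrefl u~v

  -- Each of `u` and `v` loses one neighbour with the cut edge and gains a vertex of the diamond.
  degree⁺-old : ∀ a → degree⁺ (old a) ≡ degree a
  degree⁺-old a with a ≟ u | a ≟ v
  ... | yes refl | yes refl = contradiction refl u≢v
  ... | yes refl | no  _    = trans
    (cong (suc ∘ ∣_∣) (tabulate-cong λ b → cong (λ x → does (a ~? b) ∧ not x) (∨-identityʳ (does (b ≟ v)))))
    (∣tabulate-remove∣ (does ∘ (a ~?_)) v (dec-true (a ~? v) u~v))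
  ... | no  _    | yes refl = ∣tabulate-remove∣ (does ∘ (a ~?_)) u (dec-true (a ~? u) (~-sym u~v))
  ... | no  _    | no  _    = cong ∣_∣ (tabulate-cong λ b → ∧-identityʳ (does (a ~? b)))

  cubic⁺ : Graph.Cubic G → Cubic⁺
  cubic⁺ cubic 0F = cong (2 +_) (∣tabulate-≟∣ u)
  cubic⁺ cubic 1F = cong (3 +_) (∣tabulate-⊥∣ n)
  cubic⁺ cubic 2F = cong (3 +_) (∣tabulate-⊥∣ n)
  cubic⁺ cubic 3F = cong (2 +_) (∣tabulate-≟∣ v)
  cubic⁺ cubic (suc (suc (suc (suc a)))) = trans (degree⁺-old a) (cubic a)

  -- The detour `u`, 0, 1, 3, `v` replaces the cut edge in walks of `G`.
  through : Star _~⁺_ (old u) (old v)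
  through = _◅_ {j = 0F} refl (_◅_ {j = 1F} _ (_◅_ {j = 3F} _ (refl ◅ ε)))

  edge⇒path : ∀ {a b} → a ~ b → Star _~⁺_ (old a) (old b)
  edge⇒path {a} {b} a~b with cut? a b
  ... | yes (inj₁ (refl , refl)) = through
  ... | yes (inj₂ (refl , refl)) = reverse (λ {x} {y} → ~⁺-sym {x} {y}) through
  ... | no ¬cut                  = (a~b , ¬cut) ◅ ε

  connected⁺ : Graph.Connected G → Connected⁺
  connected⁺ connected x y = toU x ◅◅ reverse (λ {x} {y} → ~⁺-sym {x} {y}) (toU y)
    where
    toU : ∀ x → Star _~⁺_ x (old u)
    toU 0F = refl ◅ ε
    toU 1F = _◅_ {j = 0F} _ (refl ◅ ε)
    toU 2F = _◅_ {j = 0F} _ (refl ◅ ε)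
    toU 3F = _◅_ {j = 1F} _ (_◅_ {j = 0F} _ (refl ◅ ε))
    toU (suc (suc (suc (suc a)))) = kleisliStar old edge⇒path (connected a u)

  module _ {colour : Fin n → Fin 9} (C : Colouring G colour) (colour-u : colour u ≡ 0F) (colour-v : colour v ≡ 1F) where
    open Colouring C using (connected; cubic; dominated; missed)

    -- Vertex 0, next to `u`, takes the colour of `v`, and vertex 3, next to `v`, that of `u`: both
    -- ends still see the colour they lost. Colour 2 in the middle completes the three centres
    -- around each new vertex.
    colour⁺ : Fin (4 + n) → Fin 9
    colour⁺ 0F = 1F
    colour⁺ 1F = 2F
    colour⁺ 2F = 2F
    colour⁺ 3F = 0F
    colour⁺ (suc (suc (suc (suc a)))) = colour a

    -- Old vertices see the same colours before and after: `lift` transports `dominated`, and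
    -- `lower` transports `missed`.
    lift : ∀ {a b} → Near G a b → ∃[ y ] Near G⁺ (old a) y × colour⁺ y ≡ colour b
    lift {a} (inj₁ refl) = old a , inj₁ refl , refl
    lift {a} {b} (inj₂ a~b) with cut? a b
    ... | yes (inj₁ (refl , refl)) = 0F , inj₂ refl , sym colour-v
    ... | yes (inj₂ (refl , refl)) = 3F , inj₂ refl , sym colour-u
    ... | no ¬cut                  = old b , inj₂ (a~b , ¬cut) , refl

    lower : ∀ {a} y → Near G⁺ (old a) y → ∃[ b ] Near G a b × colour b ≡ colour⁺ y
    lower y  (inj₁ refl) = _ , inj₁ refl , refl
    lower 0F (inj₂ refl) = v , inj₂ u~v , colour-v
    lower 3F (inj₂ refl) = u , inj₂ (~-sym u~v) , colour-u
    lower (suc (suc (suc (suc b)))) (inj₂ (a~b , _)) = b , inj₂ a~b , refl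

    dominated-centres : ∀ {x} →
      (∃[ y ] Near G⁺ x y × colour⁺ y ≡ 0F) → (∃[ y ] Near G⁺ x y × colour⁺ y ≡ 1F) →
      (∃[ y ] Near G⁺ x y × colour⁺ y ≡ 2F) →
      ∀ i → ∃[ y ] Near G⁺ x y × (colour⁺ y ≡ i ⊎ colour⁺ y ≡ partner i)
    dominated-centres c₀ c₁ c₂ i with centre-≡ i
    dominated-centres (y , near , eq) _ _ i | _ , inj₁ refl , p =
      y , near , Sum.map (trans eq) (trans eq) p
    dominated-centres _ (y , near , eq) _ i | _ , inj₂ (inj₁ refl) , p =
      y , near , Sum.map (trans eq) (trans eq) p
    dominated-centres _ _ (y , near , eq) i | _ , inj₂ (inj₂ refl) , p =
      y , near , Sum.map (trans eq) (trans eq) p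

    dominated⁺ : ∀ i x → ∃[ y ] Near G⁺ x y × (colour⁺ y ≡ i ⊎ colour⁺ y ≡ partner i)
    dominated⁺ i 0F = dominated-centres
      (old u , inj₂ refl , colour-u) (0F , inj₁ refl , refl) (1F , inj₂ _ , refl) i
    dominated⁺ i 1F = dominated-centres
      (3F , inj₂ _ , refl) (0F , inj₂ _ , refl) (1F , inj₁ refl , refl) i
    dominated⁺ i 2F = dominated-centres
      (3F , inj₂ _ , refl) (0F , inj₂ _ , refl) (2F , inj₁ refl , refl) i
    dominated⁺ i 3F = dominated-centres
      (3F , inj₁ refl , refl) (old v , inj₂ refl , colour-v) (1F , inj₂ _ , refl) i
    dominated⁺ i (suc (suc (suc (suc a)))) with dominated i a
    ... | b , near , p with lift near
    ...   | y , near⁺ , eq = y , near⁺ , Sum.map (trans eq) (trans eq) p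

    missed⁺ : ∀ i → ∃[ x ] (∀ y → Near G⁺ x y → colour⁺ y ≢ i)
    missed⁺ i with missed i
    ... | a , miss = old a , λ y near⁺ → let b , near , eq = lower y near⁺ in
      miss b near ∘ trans eq

    colouring⁺ : Colouring G⁺ colour⁺
    colouring⁺ = record
      { connected = connected⁺ connected
      ; cubic     = cubic⁺ cubic
      ; dominated = dominated⁺
      ; missed    = missed⁺
      -- The new edge from `u` to vertex 0 again has colours 0 and 1, so insertion can be repeated.
      ; u         = old u
      ; v         = 0F
      ; u~v       = refl
      ; colour-u  = colour-u
      ; colour-v  = refl
      }

-- Explicit graphs from adjacency lists

open DecMembership ℕ._≟_ using () renaming (_∈?_ to _∈ℕ?_)

module Table {m : ℕ} (nbrs : Vec (List ℕ) (suc m)) where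

  _~_ : Rel (Fin (suc m)) 0ℓ
  v ~ w = toℕ w ∈ lookup nbrs v

  _~?_ : Decidable₂ _~_
  v ~? w = toℕ w ∈ℕ? lookup nbrs v

  -- The last condition is a certificate of connectedness that can be checked by evaluation.
  valid? : Dec ((∀ v w → v ~ w → w ~ v) × (∀ v → ¬ v ~ v) × (∀ i → inject₁ i ~ suc i))
  valid? = all? (λ v → all? λ w → (v ~? w) →-dec (w ~? v))
    ×-dec all? (λ v → ¬? (v ~? v))
    ×-dec all? (λ i → inject₁ i ~? suc i)

  module Valid (valid : True valid?) where

    graph : Graph (suc m)
    graph = record
      { _~_      = _~_
      ; _~?_     = _~?_
      ; ~-sym    = λ {v} {w} → proj₁ (toWitness valid) v w
      ; ~-irrefl = λ {v} → proj₁ (proj₂ (toWitness valid)) v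
      }

    open Graph graph using (Connected; Cubic; degree; ~-sym)

    -- The vertices of a valid table are numbered along a Hamiltonian path.
    connected : Connected
    connected v w = reverse (λ {x} {y} → ~-sym {x} {y}) (from0 v) ◅◅ from0 w
      where
      from0 : ∀ x → Star _~_ zero x
      from0 = <-weakInduction (Star _~_ zero) ε
        λ i walk → walk ◅◅ (proj₂ (proj₂ (toWitness valid)) i ◅ ε)

    module _ (colours : Vec (Fin 9) (suc m)) (u v : Fin (suc m)) where

      colour : Fin (suc m) → Fin 9
      colour = lookup colours

      colouring? : Dec (
        Cubic
        × (∀ i v → ∃[ w ] Near graph v w × (colour w ≡ i ⊎ colour w ≡ partner i))
        × (∀ i → ∃[ v ] (∀ w → Near graph v w → colour w ≢ i))
        × u ~ v × colour u ≡ 0F × colour v ≡ 1F)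
      colouring? =
        all? (λ v → degree v ℕ.≟ 3)
        ×-dec all? (λ i → all? λ v → any? λ w →
          near? graph v w ×-dec (colour w ≟ i ⊎-dec colour w ≟ partner i))
        ×-dec all? (λ i → any? λ v → all? λ w → near? graph v w →-dec ¬? (colour w ≟ i))
        ×-dec (u ~? v) ×-dec colour u ≟ 0F ×-dec colour v ≟ 1F

      colouring : True colouring? → Colouring graph colour
      colouring t =
        let cubic , dominated , missed , u~v , colour-u , colour-v = toWitness t
        in record
          { connected = connected
          ; cubic     = cubic
          ; dominated = dominated
          ; missed    = missed
          ; u~v       = u~v
          ; colour-u  = colour-u
          ; colour-v  = colour-v
          }

-- Base graphs and all even orders

Coloured : ℕ → Set₁
Coloured n = ∃ λ (G : Graph n) → ∃ λ (colour : Fin n → Fin 9) → Colouring G colour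

-- The graph is `K₄` with a diamond inserted into each of the three edges at vertex 10.
coloured16 : Coloured 16
coloured16 = _ , _ , Table.Valid.colouring
  ( (1 ∷ 2 ∷ 10 ∷ []) ∷ (0 ∷ 2 ∷ 3 ∷ []) ∷ (0 ∷ 1 ∷ 3 ∷ []) ∷ (1 ∷ 2 ∷ 4 ∷ [])
  ∷ (3 ∷ 5 ∷ 15 ∷ []) ∷ (4 ∷ 6 ∷ 15 ∷ []) ∷ (5 ∷ 7 ∷ 8 ∷ []) ∷ (6 ∷ 8 ∷ 9 ∷ [])
  ∷ (6 ∷ 7 ∷ 9 ∷ []) ∷ (7 ∷ 8 ∷ 10 ∷ []) ∷ (0 ∷ 9 ∷ 11 ∷ []) ∷ (10 ∷ 12 ∷ 13 ∷ [])
  ∷ (11 ∷ 13 ∷ 14 ∷ []) ∷ (11 ∷ 12 ∷ 14 ∷ []) ∷ (12 ∷ 13 ∷ 15 ∷ []) ∷ (4 ∷ 5 ∷ 14 ∷ []) ∷ []) _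
  (1F ∷ 3F ∷ 4F ∷ 2F ∷ 1F ∷ 8F ∷ 7F ∷ 0F ∷ 1F ∷ 2F ∷ 2F ∷ 0F ∷ 5F ∷ 6F ∷ 2F ∷ 0F ∷ [])
  -- The adjacent vertices 7 and 8 have colours 0 and 1; the final `_` is settled by evaluating the
  -- decision procedure.
  7F 8F _

coloured18 : Coloured 18
coloured18 = _ , _ , Table.Valid.colouring
  ( (1 ∷ 4 ∷ 17 ∷ []) ∷ (0 ∷ 2 ∷ 3 ∷ []) ∷ (1 ∷ 3 ∷ 13 ∷ []) ∷ (1 ∷ 2 ∷ 4 ∷ [])
  ∷ (0 ∷ 3 ∷ 5 ∷ []) ∷ (4 ∷ 6 ∷ 17 ∷ []) ∷ (5 ∷ 7 ∷ 8 ∷ []) ∷ (6 ∷ 8 ∷ 15 ∷ [])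
  ∷ (6 ∷ 7 ∷ 9 ∷ []) ∷ (8 ∷ 10 ∷ 11 ∷ []) ∷ (9 ∷ 11 ∷ 12 ∷ []) ∷ (9 ∷ 10 ∷ 12 ∷ [])
  ∷ (10 ∷ 11 ∷ 13 ∷ []) ∷ (2 ∷ 12 ∷ 14 ∷ []) ∷ (13 ∷ 15 ∷ 16 ∷ []) ∷ (7 ∷ 14 ∷ 16 ∷ [])
  ∷ (14 ∷ 15 ∷ 17 ∷ []) ∷ (0 ∷ 5 ∷ 16 ∷ []) ∷ []) _
  (4F ∷ 2F ∷ 0F ∷ 1F ∷ 3F ∷ 2F ∷ 0F ∷ 1F ∷ 2F ∷ 6F ∷ 5F ∷ 0F ∷ 2F ∷ 1F ∷ 8F ∷ 7F ∷ 0F ∷ 1F ∷ [])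
  2F 3F _

insertDiamond : Coloured n → Coloured (4 + n)
insertDiamond (G , colour , C) = _ , _ , Insert.colouring⁺ G u~v C colour-u colour-v
  where open Colouring C

-- Insertion adds four vertices, so one base graph is required for each even residue modulo 4.
coloured : ∀ q → Coloured (16 + q * 2)
coloured 0             = coloured16
coloured 1             = coloured18
coloured (suc (suc q)) = insertDiamond (coloured q)

proposition1 : ∀ (n : ℕ) → 2 ∣ n → n ≥ 16 →
    ∃ λ (G : Graph n) → Graph.Connected G × Graph.Cubic G × CoalitionNumber G 9
proposition1 n (divides k refl) n≥16 with ℕ.m≤n⇒∃[o]m+o≡n (ℕ.*-cancelʳ-≤ 8 k 2 n≥16)
-- Here `k` is `8 + q`, and the order `(8 + q) * 2` computes to `16 + q * 2`.
... | q , refl with coloured q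
...   | G , colour , C = G , connected , cubic , coalitionPartition C , coalitionPartition≤9 G cubic n≥16
  where open Colouring C
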